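{- Let $1\le i<j\le N$. All but the $i$-th column of $\widetilde{\mathbf{M}}_{j,i}$ are upper-triangular; that is, for every $k\in\{1,\dots,N-1\}$ with $k\ne i$, the column $C_k^{\widetilde{\mathbf{M}}_{j,i}}$ is upper-triangular.
   Context: Let $G$ be a finite tree (connected acyclic simple graph) with nodes $n_0,n_1,\dots,n_N$, where $n_0$ is a terminal node (degree one) and the nodes are indexed so that along the path in $G$ from $n_0$ to any node $n_i$ the successively encountered node indices strictly increase. Node $n_i$ is forward-adjacent to $n_k$ if $n_i$ and $n_k$ are adjacent and $i<k$. The forward adjacency matrix $\mathbf{A}$ of $G$ is the $N\times N$ matrix, with rows and columns indexed by $1,\dots,N$, given by $\mathbf{A}(i,j)=1$ if $i=j$, $\mathbf{A}(i,j)=-1$ if $n_i$ is forward-adjacent to $n_j$, and $\mathbf{A}(i,j)=0$ otherwise. $\mathbf{M}_{j,i}$ is the $(N-1)\times(N-1)$ matrix obtained from $\mathbf{A}$ by deleting its $j$-th row and $i$-th column (rows and columns then renumbered $1,\dots,N-1$). $\widetilde{\mathbf{M}}_{j,i}$ is the matrix obtained from $\mathbf{M}_{j,i}$ by moving its $(j-1)$-th column to the $i$-th position by the successive interchanges of neighbouring columns: positions $j-1\leftrightarrow j-2$, then $j-2\leftrightarrow j-3$, ..., finally $i+1\leftrightarrow i$ (no interchange if $i=j-1$). $C^{\mathbf{Q}}_k$ denotes the $k$-th column of a matrix $\mathbf{Q}$; it is called upper-triangular if $\mathbf{Q}(x,k)=0$ for all $x>k$. -}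

module Defs where

open import Data.Fin using (Fin; zero; suc; toℕ; pred; _<_)
open import Data.Fin.Permutation.Components using (transpose)
open import Data.Fin.Properties using (_≟_; _<?_)
open import Data.Integer using (ℤ; 0ℤ; 1ℤ; -1ℤ)
open import Data.List using (List; []; _∷_; length; filter; allFin)
open import Data.List.Relation.Unary.Linked using (Linked)
open import Data.List.Relation.Unary.Unique.Propositional using (Unique)
open import Data.Nat as ℕ using (ℕ; zero; suc; _∸_)
open import Data.Product using (_×_)
open import Data.Vec.Functional using (Vector; map; removeAt)
open import Level using (0ℓ)
open import Relation.Binary.Construct.Closure.ReflexiveTransitive using (Star; ε; _◅_)
open import Relation.Binary.Core using (Rel)
open import Relation.Binary.Definitions using (Decidable; Symmetric)
open import Relation.Binary.PropositionalEquality using (_≡_)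
open import Relation.Nullary using (¬_; does)
open import Relation.Nullary.Decidable using (_×-dec_)
open import Data.Bool using (if_then_else_)

record SimpleGraph (v : ℕ) : Set₁ where
  field
    Adj      : Rel (Fin v) 0ℓ
    adj?     : Decidable Adj
    adj-sym  : Symmetric Adj
    adj-irr  : ∀ a → ¬ Adj a a

  Walk : Rel (Fin v) 0ℓ
  Walk = Star Adj

  nodes : ∀ {a b} → Walk a b → List (Fin v)
  nodes {a} ε       = a ∷ []
  nodes {a} (_ ◅ w) = a ∷ nodes w

  IsPath : ∀ {a b} → Walk a b → Set
  IsPath w = Unique (nodes w)

  Connected : Set
  Connected = ∀ a b → Walk a b

  -- A cycle is given by a path through at least three nodes together with
  -- an edge joining its last node to its first.
  Acyclic : Set
  Acyclic = ∀ {a b} (w : Walk a b) → IsPath w → 3 ℕ.≤ length (nodes w) → ¬ Adj b a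

  IsTree : Set
  IsTree = Connected × Acyclic

  degree : Fin v → ℕ
  degree a = length (filter (adj? a) (allFin v))

  IsTerminal : Fin v → Set
  IsTerminal a = degree a ≡ 1

  IncreasingFrom : Fin v → Set
  IncreasingFrom r = ∀ {a} (w : Walk r a) → IsPath w → Linked _<_ (nodes w)

  ForwardAdjacent : Rel (Fin v) 0ℓ
  ForwardAdjacent a b = Adj a b × a < b

  forwardAdjacent? : Decidable ForwardAdjacent
  forwardAdjacent? a b = adj? a b ×-dec (a <? b)

Matrix : ℕ → ℕ → Set
Matrix r c = Vector (Vector ℤ c) r

-- The node n_k is the element of Fin (suc N) with value k.  The one-based matrix
-- index i ∈ {1,…,N} is the element i - 1 of Fin N, so it belongs to the node
-- given by the constructor suc.
forwardAdjacencyMatrix : ∀ {N} → SimpleGraph (suc N) → Matrix N N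
forwardAdjacencyMatrix G i j =
  if does (i ≟ j) then 1ℤ else
  if does (forwardAdjacent? (suc i) (suc j)) then -1ℤ else 0ℤ
  where open SimpleGraph G

deleteRowColumn : ∀ {r c} → Matrix (suc r) (suc c) → Fin (suc r) → Fin (suc c) → Matrix r c
deleteRowColumn Q j i = map (λ row → removeAt row i) (removeAt Q j)

swapColumns : ∀ {r c} → Fin c → Fin c → Matrix r c → Matrix r c
swapColumns a b Q x y = Q x (transpose a b y)

-- The interchanges p ↔ p-1, then p-1 ↔ p-2, …, d of them in this order.
moveColumnLeft : ∀ {r c} → (d : ℕ) → (p : Fin c) → Matrix r c → Matrix r c
moveColumnLeft zero    p Q = Q
moveColumnLeft (suc d) p Q = moveColumnLeft d (pred p) (swapColumns p (pred p) Q)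

module _ {n : ℕ} (G : SimpleGraph (suc (suc n))) where

  M : (j i : Fin (suc n)) → Matrix n n
  M j i = deleteRowColumn (forwardAdjacencyMatrix G) j i

  -- For j = suc p, the element p of Fin n is the one-based column position
  -- j - 1 of M j i; bringing it to position i takes (j - 1) - i interchanges.
  M̃ : (j i : Fin (suc n)) → i < j → Matrix n n
  M̃ (suc p) i _ = moveColumnLeft (toℕ p ∸ toℕ i) p (M (suc p) i)

column : ∀ {r c} → Matrix r c → Fin c → Vector ℤ r
column Q k x = Q x k

UpperTriangularColumn : ∀ {n} → Matrix n n → Fin n → Set
UpperTriangularColumn Q k = ∀ x → k < x → column Q k x ≡ 0ℤ

{-# OPTIONS --safe #-}
-- The forward adjacency matrix is upper triangular, because forward adjacency
-- respects the order of the indices.  Deleting row j and column i < j can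
-- shift the entries of a column down by one place, but only for the columns
-- from i up to j - 1.  An interchange of neighbouring columns moves one of
-- these columns a place to the right, where it is upper-triangular again;
-- only the column that travels to position i escapes this.
module Submission where

open import Defs
open import Data.Nat as ℕ using (ℕ; suc; s≤s; z≤n; _∸_)
open import Data.Nat.Properties as ℕ using (≤-<-trans; <-≤-trans; ≤-reflexive)
open import Data.Fin using (Fin; zero; suc; toℕ; pred; punchIn; _<_)
open import Data.Fin.Permutation.Components using (transpose)
open import Data.Fin.Properties using (_≟_; toℕ-inject₁; toℕ-injective; <⇒≢)
open import Data.Integer using (0ℤ)
open import Data.Product using (proj₂)
open import Data.Sum using (inj₁; inj₂)
open import Function using (_∘_)
open import Relation.Binary.Definitions using (tri<; tri≈; tri>)
open import Relation.Binary.PropositionalEquality using (_≡_; _≢_; refl; sym; trans; cong; subst)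
open import Relation.Nullary using (contradiction)
open import Relation.Nullary.Decidable using (dec-false; dec-true)

punchIn-≥ : ∀ {n} (i : Fin (suc n)) (x : Fin n) → toℕ x ℕ.≤ toℕ (punchIn i x)
punchIn-≥ zero    x       = ℕ.n≤1+n (toℕ x)
punchIn-≥ (suc i) zero    = z≤n
punchIn-≥ (suc i) (suc x) = s≤s (punchIn-≥ i x)

punchIn-≤suc : ∀ {n} (i : Fin (suc n)) (x : Fin n) → toℕ (punchIn i x) ℕ.≤ suc (toℕ x)
punchIn-≤suc zero    x       = ℕ.≤-refl
punchIn-≤suc (suc i) zero    = z≤n
punchIn-≤suc (suc i) (suc x) = s≤s (punchIn-≤suc i x)

toℕ-punchIn-< : ∀ {n} (i : Fin (suc n)) (x : Fin n) → toℕ x ℕ.< toℕ i → toℕ (punchIn i x) ≡ toℕ x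
toℕ-punchIn-< (suc i) zero    _         = refl
toℕ-punchIn-< (suc i) (suc x) (s≤s x<i) = cong suc (toℕ-punchIn-< i x x<i)

toℕ-punchIn-≥ : ∀ {n} (i : Fin (suc n)) (x : Fin n) → toℕ i ℕ.≤ toℕ x → toℕ (punchIn i x) ≡ suc (toℕ x)
toℕ-punchIn-≥ zero    x       _         = refl
toℕ-punchIn-≥ (suc i) (suc x) (s≤s i≤x) = cong suc (toℕ-punchIn-≥ i x i≤x)

transpose-matchˡ : ∀ {n} (a b : Fin n) → transpose a b a ≡ b
transpose-matchˡ a b rewrite dec-true (a ≟ a) refl = refl

transpose-mismatch : ∀ {n} (a b : Fin n) {y : Fin n} → y ≢ a → y ≢ b → transpose a b y ≡ y
transpose-mismatch a b {y} y≢a y≢b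
  rewrite dec-false (y ≟ a) y≢a | dec-false (y ≟ b) y≢b = refl

forwardAdjacencyMatrix-upper : ∀ {N} (G : SimpleGraph (suc N)) (k : Fin N) →
  UpperTriangularColumn (forwardAdjacencyMatrix G) k
forwardAdjacencyMatrix-upper G k x k<x
  rewrite dec-false (x ≟ k) (<⇒≢ k<x ∘ sym)
        | dec-false (SimpleGraph.forwardAdjacent? G (suc x) (suc k)) (λ x→k → ℕ.<-asym k<x (ℕ.≤-pred (proj₂ x→k)))
        = refl

-- The state of the matrix when the travelling column is at position p on its
-- way to position i.
record UpperExcept {n : ℕ} (i p : ℕ) (Q : Matrix n n) : Set where
  field
    left   : ∀ y → toℕ y ℕ.< i → UpperTriangularColumn Q y
    middle : ∀ y → toℕ y ℕ.< p → ∀ x → suc (toℕ y) ℕ.< toℕ x → Q x y ≡ 0ℤ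
    right  : ∀ y → p ℕ.< toℕ y → UpperTriangularColumn Q y

open UpperExcept

-- Entries are traced back to `A`: row indices never drop, and column indices rise by at most one,
-- not at all left of `i`. A rise of the column alone costs one place below the diagonal, the slack
-- granted in `middle`.
deleteRowColumn-upperExcept : ∀ {n} (A : Matrix (suc n) (suc n)) → (∀ k → UpperTriangularColumn A k) →
  (i : Fin (suc n)) (p : Fin n) →
  UpperExcept (toℕ i) (toℕ p) (deleteRowColumn A (suc p) i)
deleteRowColumn-upperExcept A upper i p = record
  { left   = λ y y<i x y<x → upper _ _
      (≤-<-trans (≤-reflexive (toℕ-punchIn-< i y y<i)) (<-≤-trans y<x (punchIn-≥ (suc p) x)))
  ; middle = λ y _ x 1+y<x → upper _ _
      (≤-<-trans (punchIn-≤suc i y) (<-≤-trans 1+y<x (punchIn-≥ (suc p) x)))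
  -- Here `x` lies beyond `p`, so its row index rises by one too and makes up for the shift of the
  -- column.
  ; right  = λ y p<y x y<x → upper _ _
      (≤-<-trans (punchIn-≤suc i y)
        (<-≤-trans (s≤s y<x) (≤-reflexive (sym (toℕ-punchIn-≥ (suc p) x (ℕ.<-trans p<y y<x))))))
  }

-- The travelling column lands on `b`, which no field of the new state constrains, and `i ≤ b` keeps
-- the interchange clear of the columns under `left`.
swapColumns-upperExcept : ∀ {n i} {Q : Matrix n n} (a b : Fin n) → toℕ a ≡ suc (toℕ b) → i ℕ.≤ toℕ b →
  UpperExcept i (toℕ a) Q → UpperExcept i (toℕ b) (swapColumns a b Q)
swapColumns-upperExcept {i = i} {Q} a b a≡1+b i≤b U = record
  { left   = λ y y<i x y<x → trans (below y (<-≤-trans y<i i≤b) x) (left U y y<i x y<x)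
  ; middle = λ y y<b x 1+y<x → trans (below y y<b x) (middle U y (ℕ.<-trans y<b b<a) x 1+y<x)
  ; right  = right′
  }
  where
  b<a : b < a
  b<a = ≤-reflexive (sym a≡1+b)

  below : ∀ y → y < b → ∀ x → swapColumns a b Q x y ≡ Q x y
  below y y<b x = cong (Q x) (transpose-mismatch a b (<⇒≢ (ℕ.<-trans y<b b<a)) (<⇒≢ y<b))

  right′ : ∀ y → b < y → UpperTriangularColumn (swapColumns a b Q) y
  right′ y b<y x y<x with ℕ.m≤n⇒m<n∨m≡n (subst (ℕ._≤ toℕ y) (sym a≡1+b) b<y)
  ... | inj₁ a<y = trans (cong (Q x) (transpose-mismatch a b (<⇒≢ a<y ∘ sym) (<⇒≢ b<y ∘ sym)))
                         (right U y a<y x y<x)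
  -- Position `a` now holds the old column `b`. As `a` is one more than `b`, `middle` at `b` is
  -- exactly upper-triangularity at `a`.
  ... | inj₂ a≡y with refl ← toℕ-injective a≡y =
    trans (cong (Q x) (transpose-matchˡ a b)) (middle U b b<a x (subst (ℕ._< toℕ x) a≡1+b y<x))

moveColumnLeft-upperExcept : ∀ {n i} {Q : Matrix n n} (d : ℕ) (p : Fin n) → toℕ p ≡ d ℕ.+ i →
  UpperExcept i (toℕ p) Q → UpperExcept i i (moveColumnLeft d p Q)
moveColumnLeft-upperExcept {Q = Q} 0 p p≡i U = subst (λ m → UpperExcept _ m Q) p≡i U
-- The equation for `p` rules out position zero, where `pred` would stay put instead of stepping
-- left.
moveColumnLeft-upperExcept {i = i} (suc d) (suc q) p≡ U =
  moveColumnLeft-upperExcept d (pred (suc q)) b≡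
    (swapColumns-upperExcept (suc q) (pred (suc q)) (cong suc (sym (toℕ-inject₁ q)))
      (subst (i ℕ.≤_) (sym b≡) (ℕ.m≤n+m i d)) U)
  where
  b≡ : toℕ (pred (suc q)) ≡ d ℕ.+ i
  b≡ = trans (toℕ-inject₁ q) (ℕ.suc-injective p≡)

corollary10p1 : (n : ℕ) (G : SimpleGraph (suc (suc n))) →
    SimpleGraph.IsTree G → SimpleGraph.IsTerminal G zero → SimpleGraph.IncreasingFrom G zero →
    (i j : Fin (suc n)) (i<j : i < j) →
    (k : Fin n) → toℕ k ≢ toℕ i →
    UpperTriangularColumn (M̃ G j i i<j) k
corollary10p1 n G _ _ _ i (suc p) i<j@(s≤s i≤p) k k≢i = upper
  where
  moved : UpperExcept (toℕ i) (toℕ i) (M̃ G (suc p) i i<j)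
  -- Since `i ≤ p`, the truncated subtraction is exact and the column stops at `i`.
  moved = moveColumnLeft-upperExcept (toℕ p ∸ toℕ i) p (sym (ℕ.m∸n+n≡m i≤p))
    (deleteRowColumn-upperExcept _ (forwardAdjacencyMatrix-upper G) i p)

  upper : UpperTriangularColumn (M̃ G (suc p) i i<j) k
  -- With both bounds equal to `i`, `left` and `right` together miss only column `i`.
  upper with ℕ.<-cmp (toℕ k) (toℕ i)
  ... | tri< k<i _ _ = left moved k k<i
  ... | tri≈ _ k≡i _ = contradiction k≡i k≢i
  ... | tri> _ _ i<k = right moved k i<k
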